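{- For every integer $k \ge 0$, $|I_k(132)|$ is equal to the number of integer partitions of $k$.
   Context: A permutation of length $n$ is a word $\pi=\pi_1\cdots\pi_n$ containing each of $1,\dots,n$ exactly once. The sum of permutations $\rho=\rho_1\cdots\rho_n$ and $\tau=\tau_1\cdots\tau_m$ is the permutation $\rho\oplus\tau=\rho_1\cdots\rho_n(n+\tau_1)\cdots(n+\tau_m)$ of length $n+m$. A permutation is decomposable if it equals $\rho\oplus\tau$ for some non-empty permutations $\rho,\tau$; a non-empty permutation that is not decomposable is indecomposable. An inversion of $\pi$ is a pair $(i,j)$ with $i<j$ and $\pi_i>\pi_j$. A permutation $\pi$ contains a permutation (pattern) $\tau=\tau_1\cdots\tau_m$ if there are indices $i_1<\dots<i_m$ such that $\pi_{i_1},\dots,\pi_{i_m}$ is order-isomorphic to $\tau_1,\dots,\tau_m$; otherwise $\pi$ avoids $\tau$. $I_k(\tau_1,\dots,\tau_r)$ denotes the (finite) set of all indecomposable permutations, of any length, with exactly $k$ inversions that avoid all of $\tau_1,\dots,\tau_r$. -}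

module Defs where

open import Data.Fin using (Fin) renaming (_<_ to _<ᶠ_; _<?_ to _<ᶠ?_)
open import Data.List using (List; []; _∷_; _++_; length; map; upTo; lookup; filter; allFin; cartesianProduct)
open import Data.List.Membership.Propositional using (_∈_)
open import Data.List.Relation.Binary.Permutation.Propositional using (_↭_)
open import Data.List.Relation.Unary.All using (All)
open import Data.List.Relation.Unary.Linked using (Linked)
open import Data.List.Relation.Unary.Unique.Propositional using (Unique)
open import Data.Nat using (ℕ; suc; _+_; _<_; _>_; _≥_; _>?_)
open import Data.Nat.ListAction using (sum)
open import Data.Product using (Σ-syntax; ∃-syntax; _×_; _,_)
open import Function using (_⇔_)
open import Level using (0ℓ)
open import Relation.Binary.PropositionalEquality using (_≡_; _≢_)
open import Relation.Nullary using (¬_)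
open import Relation.Nullary.Decidable using (_×-dec_)
open import Relation.Unary using (Pred; Decidable)

-- A permutation is a word in the values 1, …, n; positions are counted from 0 by Fin n.

Word : Set
Word = List ℕ

IsPermutation : Pred Word 0ℓ
IsPermutation π = π ↭ map suc (upTo (length π))

infixr 6 _⊕_

_⊕_ : Word → Word → Word
ρ ⊕ τ = ρ ++ map (length ρ +_) τ

Decomposable : Pred Word 0ℓ
Decomposable π =
  ∃[ ρ ] ∃[ τ ] IsPermutation ρ × ρ ≢ [] × IsPermutation τ × τ ≢ [] × π ≡ ρ ⊕ τ

Indecomposable : Pred Word 0ℓ
Indecomposable π = π ≢ [] × ¬ Decomposable π

Inversion : (π : Word) → Pred (Fin (length π) × Fin (length π)) 0ℓ
Inversion π (i , j) = i <ᶠ j × lookup π i > lookup π j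

inversion? : (π : Word) → Decidable (Inversion π)
inversion? π (i , j) = (i <ᶠ? j) ×-dec (lookup π i >? lookup π j)

inversions : Word → ℕ
inversions π = length (filter (inversion? π) (cartesianProduct positions positions))
  where
  positions : List (Fin (length π))
  positions = allFin (length π)

Contains : Word → Word → Set
Contains π τ =
  Σ[ ι ∈ (Fin (length τ) → Fin (length π)) ]
    (∀ a b → a <ᶠ b → ι a <ᶠ ι b) ×
    (∀ a b → lookup τ a < lookup τ b ⇔ lookup π (ι a) < lookup π (ι b))

Avoids : Word → Word → Set
Avoids π τ = ¬ Contains π τ

I : ℕ → List Word → Pred Word 0ℓ
I k τs π =
  IsPermutation π × Indecomposable π × inversions π ≡ k × All (Avoids π) τs

-- An integer partition is the weakly decreasing list of its parts.

IsPartitionOf : ℕ → Pred (List ℕ) 0ℓ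
IsPartitionOf k parts = Linked _≥_ parts × All (_> 0) parts × sum parts ≡ k

-- The subset {x | P x} of A is finite with exactly n elements.

HasCardinality : {A : Set} → Pred A 0ℓ → ℕ → Set
HasCardinality {A} P n =
  Σ[ xs ∈ List A ] Unique xs × (∀ x → x ∈ xs ⇔ P x) × length xs ≡ n

{-# OPTIONS --safe #-}
module Submission where

-- The bijection between partitions and permutations is the Lehmer code, which
-- records for each letter of a word the number of later and smaller letters.
-- Its sum is the number of inversions (inversions≡sum-code), and it determines
-- a permutation (code-injective-permutation).
--
-- A permutation avoids 132 exactly when its code is weakly decreasing
-- (avoids⇒decreasing, decreasing⇒avoids). Hence the positive entries of the code
-- of a 132-avoiding permutation with k inversions are the parts of a partition
-- of k, and the code consists of these parts followed by zeros. So only the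
-- length of the permutation is lost, and indecomposability is what fixes it.
--
-- In the other direction, fromParts builds from a list of positive parts the shortest
-- non-empty permutation whose code is that list followed by zeros: every
-- non-empty word π has at least the length of fromParts (parts π)
-- (length-fromParts-parts). Adding zeros to a code amounts to adding an identity
-- summand, so a 132-avoiding non-empty permutation π is the sum of
-- fromParts (parts π) and an identity permutation (fromParts-⊕-identity). If π is
-- indecomposable, this summand is empty (fromParts-parts).
--
-- Conversely, let fromParts ps be the sum of non-empty permutations ρ and τ. The
-- last entry of the code of ρ is zero, so by monotonicity the code of τ
-- vanishes, and the parts of ρ are ps. Then ρ is at least as long as fromParts ps,
-- although it is a proper prefix of it (fromParts-indecomposable).

open import Data.Empty using (⊥)
open import Data.Fin using (Fin; zero; suc) renaming (_<_ to _<ᶠ_)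
open import Data.List using (List; []; _∷_; _++_; length; map; upTo; applyUpTo; lookup; filter; allFin; tabulate; cartesianProduct; cartesianProductWith; replicate; deduplicate)
open import Data.List.Membership.Propositional using (_∈_; find)
open import Data.List.Membership.Propositional.Properties using (∈-map⁺; ∈-map⁻; ∈-filter⁺; ∈-filter⁻; ∈-deduplicate⁺; ∈-cartesianProductWith⁺; ∈-upTo⁺)
open import Data.List.Properties using (++-assoc; ++-identityʳ; filter-++; filter-accept; filter-all; filter-none; filter-reject; filter-≐; length-++; length-filter; length-map; length-replicate; length-upTo; map-++; map-cong; map-cong-local; map-id-local; map-tabulate; map-upTo; map-∘; tabulate-cong; tabulate-lookup; ∷-injectiveʳ; ∷-injectiveˡ; ≡-dec)
open import Data.List.Relation.Binary.Permutation.Propositional using (_↭_; ↭-refl; ↭-sym; ↭-trans; ↭-reflexive; prep; ↭⇒↭ₛ)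
open import Data.List.Relation.Binary.Permutation.Propositional.Properties using (All-resp-↭; map⁺; ++⁺; shift; drop-∷; ↭-length; filter-↭)
import Data.List.Relation.Binary.Permutation.Setoid.Properties as Permutationₛ
open import Data.List.Relation.Binary.Sublist.Propositional using (_⊆_; []; _∷_; _∷ʳ_; from∈; to∈; minimum)
open import Data.List.Relation.Binary.Sublist.Propositional.Properties using (∷ˡ⁻)
open import Data.List.Relation.Unary.All as All using (All; []; _∷_)
import Data.List.Relation.Unary.All.Properties as All
open import Data.List.Relation.Unary.AllPairs as AllPairs using (AllPairs; []; _∷_)
import Data.List.Relation.Unary.AllPairs.Properties as AllPairs
open import Data.List.Relation.Unary.Any using (Any; here; there)
open import Data.List.Relation.Unary.Linked as Linked using (Linked; []; [-]; _∷_)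
import Data.List.Relation.Unary.Linked.Properties as Linked
open import Data.List.Relation.Unary.Unique.DecPropositional.Properties using (deduplicate-!)
open import Data.List.Relation.Unary.Unique.Propositional using (Unique)
import Data.List.Relation.Unary.Unique.Propositional.Properties as Unique
open import Data.Nat using (ℕ; zero; suc; _+_; _∸_; _≤_; _<_; _>_; _≥_; z≤n; s≤s; s≤s⁻¹; z<s; s<s; s<s⁻¹; _<?_; _>?_; _≥?_)
open import Data.Nat.ListAction using (sum)
open import Data.Nat.ListAction.Properties using (sum-++)
open import Data.Nat.Properties using (+-cancelˡ-<; +-cancelˡ-≡; +-comm; +-identityʳ; +-monoʳ-<; +-monoʳ-≤; +-suc; <-asym; <-cmp; <-irrefl; <-trans; <-≤-connex; <-≤-trans; <⇒≢; <⇒≤; <⇒≱; _≟_; m+[n∸m]≡n; m+n≤o⇒m≤o; m+n≤o⇒n≤o; m<m+n; m≤m+n; m≤n+m∸n; m≤n⇒m≤1+n; n≤1+n; suc-injective; ∸-monoˡ-≤; ≤-<-trans; ≤-refl; ≤-reflexive; ≤-trans; ≤⇒≯; ≤∧≢⇒<; ≮⇒≥; module ≤-Reasoning)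
open import Data.Sum using (_⊎_; inj₁; inj₂)
open import Data.Product using (∃-syntax; _×_; _,_; proj₁; proj₂)
open import Function using (_∘_; id; _⇔_; mk⇔; Equivalence)
open import Level using (0ℓ)
open import Relation.Binary.Definitions using (tri<; tri≈; tri>)
open import Relation.Binary.PropositionalEquality using (_≡_; _≢_; refl; sym; trans; cong; cong₂; subst; subst₂; setoid; module ≡-Reasoning)
open import Relation.Nullary using (¬_; yes; no; contradiction)
open import Relation.Nullary.Decidable using (_×-dec_)
open import Relation.Unary using (Pred; Decidable)
open import Defs

-- Words and the number of letters below a bound

length-filter-map : ∀ {A B : Set} {P : Pred B 0ℓ} (P? : Decidable P) (f : A → B) xs →
  length (filter P? (map f xs)) ≡ length (filter (P? ∘ f) xs)
length-filter-map P? f [] = refl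
length-filter-map P? f (x ∷ xs) with P? (f x)
... | yes _ = cong suc (length-filter-map P? f xs)
... | no  _ = length-filter-map P? f xs

-- The number of letters of w that are smaller than x.
below : ℕ → Word → ℕ
below x w = length (filter (_<? x) w)

below-step : ∀ x y w →
  (y < x × below x (y ∷ w) ≡ suc (below x w)) ⊎ (x ≤ y × below x (y ∷ w) ≡ below x w)
below-step x y w with <-≤-connex y x
... | inj₁ y<x = inj₁ (y<x , cong length (filter-accept (_<? x) y<x))
... | inj₂ x≤y = inj₂ (x≤y , cong length (filter-reject (_<? x) (≤⇒≯ x≤y)))

below-∷ : ∀ x y w → below x w ≤ below x (y ∷ w)
below-∷ x y w with below-step x y w
... | inj₁ (_ , eq) = ≤-trans (n≤1+n _) (≤-reflexive (sym eq))
... | inj₂ (_ , eq) = ≤-reflexive (sym eq)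

below-∷-≥ : ∀ {x y} w → x ≤ y → below x (y ∷ w) ≡ below x w
below-∷-≥ w x≤y = cong length (filter-reject (_<? _) (≤⇒≯ x≤y))

below-none : ∀ {x w} → All (x ≤_) w → below x w ≡ 0
below-none x≤w = cong length (filter-none (_<? _) (All.map ≤⇒≯ x≤w))

below-++ : ∀ x v w → below x (v ++ w) ≡ below x v + below x w
below-++ x v w = trans (cong length (filter-++ (_<? x) v w)) (length-++ (filter (_<? x) v))

below-↭ : ∀ x {v w} → v ↭ w → below x v ≡ below x w
below-↭ x v↭w = ↭-length (filter-↭ (_<? x) v↭w)

below-mono : ∀ {x y} w → x ≤ y → below x w ≤ below y w
below-mono [] x≤y = z≤n
below-mono {x} {y} (z ∷ w) x≤y with below-step x z w | below-step y z w
... | inj₁ (_ , p)   | inj₁ (_ , q)   rewrite p | q = s≤s (below-mono w x≤y)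
... | inj₁ (z<x , _) | inj₂ (y≤z , _) = contradiction (<-≤-trans z<x (≤-trans x≤y y≤z)) (<-irrefl refl)
... | inj₂ (_ , p)   | inj₁ (_ , q)   rewrite p | q = m≤n⇒m≤1+n (below-mono w x≤y)
... | inj₂ (_ , p)   | inj₂ (_ , q)   rewrite p | q = below-mono w x≤y

below-strict : ∀ {x y z w} → z ∈ w → x ≤ z → z < y → below x w < below y w
below-strict {x} {y} {w = u ∷ w} z∈w x≤z z<y with below-step x u w | below-step y u w
below-strict (here refl) x≤z z<y | inj₁ (z<x , _) | _              = contradiction z<x (≤⇒≯ x≤z)
below-strict (here refl) x≤z z<y | _              | inj₂ (y≤z , _) = contradiction z<y (≤⇒≯ y≤z)
below-strict {w = u ∷ w} (here refl) x≤z z<y | inj₂ (_ , p) | inj₁ (_ , q)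
  rewrite p | q = s≤s (below-mono w (≤-trans x≤z (<⇒≤ z<y)))
below-strict (there z∈w) x≤z z<y | inj₁ (_ , p)   | inj₁ (_ , q)   rewrite p | q = s≤s (below-strict z∈w x≤z z<y)
below-strict (there z∈w) x≤z z<y | inj₁ (u<x , _) | inj₂ (y≤u , _) =
  contradiction (<-≤-trans (<-trans u<x (≤-<-trans x≤z z<y)) y≤u) (<-irrefl refl)
below-strict (there z∈w) x≤z z<y | inj₂ (_ , p)   | inj₁ (_ , q)   rewrite p | q = m≤n⇒m≤1+n (below-strict z∈w x≤z z<y)
below-strict (there z∈w) x≤z z<y | inj₂ (_ , p)   | inj₂ (_ , q)   rewrite p | q = below-strict z∈w x≤z z<y

below-gap : ∀ {x y} w → below x w < below y w → Any (λ z → x ≤ z × z < y) w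
below-gap {x} {y} (z ∷ w) lt with below-step x z w | below-step y z w
... | inj₁ (_ , p)   | inj₁ (_ , q)   rewrite p | q = there (below-gap w (s<s⁻¹ lt))
... | inj₁ (_ , p)   | inj₂ (_ , q)   rewrite p | q = there (below-gap w (<⇒≤ lt))
... | inj₂ (x≤z , _) | inj₁ (z<y , _) = here (x≤z , z<y)
... | inj₂ (_ , p)   | inj₂ (_ , q)   rewrite p | q = there (below-gap w lt)

-- The code of a word

-- The Lehmer code: for each letter, the number of later and smaller letters.
code : Word → List ℕ
code []      = []
code (x ∷ w) = below x w ∷ code w

length-code : ∀ w → length (code w) ≡ length w
length-code []      = refl
length-code (x ∷ w) = cong suc (length-code w)

length-filter-cartesianProduct : ∀ {A B : Set} {P : Pred (A × B) 0ℓ} (P? : Decidable P) xs ys →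
  length (filter P? (cartesianProduct xs ys)) ≡ sum (map (λ x → length (filter (λ y → P? (x , y)) ys)) xs)
length-filter-cartesianProduct P? []       ys = refl
length-filter-cartesianProduct P? (x ∷ xs) ys = begin
  length (filter P? (map (x ,_) ys ++ cartesianProduct xs ys))
    ≡⟨ cong length (filter-++ P? (map (x ,_) ys) _) ⟩
  length (filter P? (map (x ,_) ys) ++ filter P? (cartesianProduct xs ys))
    ≡⟨ length-++ (filter P? (map (x ,_) ys)) ⟩
  length (filter P? (map (x ,_) ys)) + length (filter P? (cartesianProduct xs ys))
    ≡⟨ cong₂ _+_ (length-filter-map P? (x ,_) ys) (length-filter-cartesianProduct P? xs ys) ⟩
  length (filter (λ y → P? (x , y)) ys) + sum (map (λ x → length (filter (λ y → P? (x , y)) ys)) xs) ∎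
  where open ≡-Reasoning

-- The number of inversions whose first position is i.
inversionsFrom : (w : Word) → Fin (length w) → ℕ
inversionsFrom w i = length (filter (λ j → inversion? w (i , j)) (allFin (length w)))

-- Reindexing the positions after the first one by the positions of the tail.
length-filter-suc : ∀ {n} {P : Pred (Fin (suc n)) 0ℓ} {Q : Pred (Fin n) 0ℓ} (P? : Decidable P) (Q? : Decidable Q) →
  (∀ j → P (suc j) → Q j) → (∀ j → Q j → P (suc j)) →
  length (filter P? (tabulate {n = n} suc)) ≡ length (filter Q? (allFin n))
length-filter-suc {n} P? Q? P⇒Q Q⇒P = begin
  length (filter P? (tabulate suc))         ≡⟨ cong (length ∘ filter P?) (map-tabulate id suc) ⟨
  length (filter P? (map suc (allFin n)))   ≡⟨ length-filter-map P? suc (allFin n) ⟩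
  length (filter (P? ∘ suc) (allFin n))     ≡⟨ cong length (filter-≐ (P? ∘ suc) Q? ((λ {j} → P⇒Q j) , (λ {j} → Q⇒P j)) (allFin n)) ⟩
  length (filter Q? (allFin n))             ∎
  where open ≡-Reasoning

inversionsFrom-zero : ∀ x w → inversionsFrom (x ∷ w) zero ≡ below x w
inversionsFrom-zero x w = begin
  inversionsFrom (x ∷ w) zero
    ≡⟨ length-filter-suc (λ j → inversion? (x ∷ w) (zero , j)) (λ j → lookup w j <? x) (λ _ → proj₂) (λ _ w<x → z<s , w<x) ⟩
  length (filter (λ j → lookup w j <? x) (allFin (length w)))
    ≡⟨ length-filter-map (_<? x) (lookup w) (allFin (length w)) ⟨
  below x (map (lookup w) (allFin (length w)))
    ≡⟨ cong (below x) (trans (map-tabulate id (lookup w)) (tabulate-lookup w)) ⟩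
  below x w ∎
  where open ≡-Reasoning

inversionsFrom-suc : ∀ x w i → inversionsFrom (x ∷ w) (suc i) ≡ inversionsFrom w i
inversionsFrom-suc x w i =
  length-filter-suc (λ j → inversion? (x ∷ w) (suc i , j)) (λ j → inversion? w (i , j))
    (λ { j (lt , gt) → s<s⁻¹ lt , gt }) (λ { j (lt , gt) → s<s lt , gt })

tabulate-inversionsFrom : ∀ w → tabulate (inversionsFrom w) ≡ code w
tabulate-inversionsFrom []      = refl
tabulate-inversionsFrom (x ∷ w) = cong₂ _∷_ (inversionsFrom-zero x w)
  (trans (tabulate-cong (inversionsFrom-suc x w)) (tabulate-inversionsFrom w))

inversions≡sum-code : ∀ w → inversions w ≡ sum (code w)
inversions≡sum-code w = begin
  inversions w                                   ≡⟨ length-filter-cartesianProduct (inversion? w) (allFin _) (allFin _) ⟩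
  sum (map (inversionsFrom w) (allFin (length w))) ≡⟨ cong sum (map-tabulate id (inversionsFrom w)) ⟩
  sum (tabulate (inversionsFrom w))              ≡⟨ cong sum (tabulate-inversionsFrom w) ⟩
  sum (code w)                                   ∎
  where open ≡-Reasoning

-- The first letters of two rearrangements of the same letters, say x < y, have
-- different code entries, since x itself is counted below y but not below x.
head-≮ : ∀ {x y v w} → (x ∷ v) ↭ (y ∷ w) → below x v ≡ below y w → ¬ (x < y)
head-≮ {x} {y} {v} {w} v↭w eq x<y = <⇒≢ (below-strict {w = x ∷ v} (here refl) ≤-refl x<y) (begin
  below x (x ∷ v) ≡⟨ below-∷-≥ v ≤-refl ⟩
  below x v       ≡⟨ eq ⟩
  below y w       ≡⟨ below-∷-≥ w ≤-refl ⟨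
  below y (y ∷ w) ≡⟨ below-↭ y v↭w ⟨
  below y (x ∷ v) ∎)
  where open ≡-Reasoning

code-injective : ∀ {v w} → v ↭ w → code v ≡ code w → v ≡ w
code-injective {[]}    {[]}    _   _  = refl
code-injective {x ∷ v} {y ∷ w} v↭w eq with <-cmp x y
... | tri< x<y _ _    = contradiction x<y (head-≮ v↭w (∷-injectiveˡ eq))
... | tri> _ _ y<x    = contradiction y<x (head-≮ (↭-sym v↭w) (sym (∷-injectiveˡ eq)))
... | tri≈ _ refl _   = cong (x ∷_) (code-injective (drop-∷ v↭w) (∷-injectiveʳ eq))

-- Strict monotonicity, in the form of preserving and reflecting the order.
StrictlyMonotone : (ℕ → ℕ) → Set
StrictlyMonotone g = ∀ x y → x < y ⇔ g x < g y

below-map : ∀ {g} → StrictlyMonotone g → ∀ x w → below (g x) (map g w) ≡ below x w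
below-map {g} g-mono x w = trans (length-filter-map (_<? g x) g w)
  (cong length (filter-≐ (λ y → g y <? g x) (_<? x)
    ((λ {y} → Equivalence.from (g-mono y x)) , (λ {y} → Equivalence.to (g-mono y x))) w))

code-map : ∀ {g} → StrictlyMonotone g → ∀ w → code (map g w) ≡ code w
code-map g-mono []      = refl
code-map g-mono (x ∷ w) = cong₂ _∷_ (below-map g-mono x w) (code-map g-mono w)

+-strictlyMonotone : ∀ n → StrictlyMonotone (n +_)
+-strictlyMonotone n x y = mk⇔ (+-monoʳ-< n) (+-cancelˡ-< n x y)

-- A sum of words has the concatenation of the two codes; n stands for the length
-- of ρ, but any bound on the letters of ρ will do.
code-++ : ∀ n ρ τ → All (_≤ n) ρ → All (0 <_) τ → code (ρ ++ map (n +_) τ) ≡ code ρ ++ code τ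
code-++ n []      τ _         τ>0 = code-map (+-strictlyMonotone n) τ
code-++ n (x ∷ ρ) τ (x≤n ∷ ρ≤n) τ>0 = cong₂ _∷_
  (begin
    below x (ρ ++ map (n +_) τ)          ≡⟨ below-++ x ρ _ ⟩
    below x ρ + below x (map (n +_) τ)   ≡⟨ cong (below x ρ +_) (below-none (All.map⁺ (All.map (λ {t} _ → ≤-trans x≤n (m≤m+n n t)) τ>0))) ⟩
    below x ρ + 0                        ≡⟨ +-identityʳ _ ⟩
    below x ρ                            ∎)
  (code-++ n ρ τ ρ≤n τ>0)
  where open ≡-Reasoning

-- Occurrences of the pattern 132

-- The pattern 132 occurs as a subword x y z with x < z < y.
Has132 : Word → Set
Has132 w = ∃[ x ] ∃[ y ] ∃[ z ] x ∷ y ∷ z ∷ [] ⊆ w × x < z × z < y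

pair-⊆ : ∀ (w : Word) {i j} → i <ᶠ j → lookup w i ∷ lookup w j ∷ [] ⊆ w
pair-⊆ (x ∷ w) {zero}  {suc j} _   = refl ∷ single w j
  where
  single : ∀ (w : Word) j → lookup w j ∷ [] ⊆ w
  single (x ∷ w) zero    = refl ∷ minimum w
  single (x ∷ w) (suc j) = x ∷ʳ single w j
pair-⊆ (x ∷ w) {suc i} {suc j} i<j = x ∷ʳ pair-⊆ w (s<s⁻¹ i<j)

triple-⊆ : ∀ (w : Word) {i j k} → i <ᶠ j → j <ᶠ k → lookup w i ∷ lookup w j ∷ lookup w k ∷ [] ⊆ w
triple-⊆ (x ∷ w) {zero}  {suc j} {suc k} _   j<k = refl ∷ pair-⊆ w (s<s⁻¹ j<k)
triple-⊆ (x ∷ w) {suc i} {suc j} {suc k} i<j j<k = x ∷ʳ triple-⊆ w (s<s⁻¹ i<j) (s<s⁻¹ j<k)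

-- The positions of a subword.
positions : ∀ {v w : Word} → v ⊆ w → Fin (length v) → Fin (length w)
positions (y ∷ʳ s) i       = suc (positions s i)
positions (_ ∷ s)  zero    = zero
positions (_ ∷ s)  (suc i) = suc (positions s i)

positions-mono : ∀ {v w} (s : v ⊆ w) i j → i <ᶠ j → positions s i <ᶠ positions s j
positions-mono (y ∷ʳ s) i       j       i<j = s<s (positions-mono s i j i<j)
positions-mono (_ ∷ s)  zero    (suc j) _   = z<s
positions-mono (_ ∷ s)  (suc i) (suc j) i<j = s<s (positions-mono s i j (s<s⁻¹ i<j))

lookup-positions : ∀ {v w} (s : v ⊆ w) i → lookup w (positions s i) ≡ lookup v i
lookup-positions (y ∷ʳ s)   i       = lookup-positions s i
lookup-positions (refl ∷ s) zero    = refl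
lookup-positions (refl ∷ s) (suc i) = lookup-positions s i

p132 : Word
p132 = 1 ∷ 3 ∷ 2 ∷ []

contains⇒has132 : ∀ w → Contains w p132 → Has132 w
contains⇒has132 w (ι , ι-mono , ι-iso) =
  lookup w (ι zero) , lookup w (ι (suc zero)) , lookup w (ι (suc (suc zero))) ,
  triple-⊆ w (ι-mono zero (suc zero) z<s) (ι-mono (suc zero) (suc (suc zero)) (s<s z<s)) ,
  Equivalence.to (ι-iso zero (suc (suc zero))) (s<s z<s) ,
  Equivalence.to (ι-iso (suc (suc zero)) (suc zero)) (s<s (s<s z<s))

132-isomorphic : ∀ {x y z} → x < z → z < y → ∀ a b →
  lookup p132 a < lookup p132 b ⇔ lookup (x ∷ y ∷ z ∷ []) a < lookup (x ∷ y ∷ z ∷ []) b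
132-isomorphic {x} {y} {z} x<z z<y = iso
  where
  both : ∀ {A B : Set} → A → B → A ⇔ B
  both a b = mk⇔ (λ _ → b) (λ _ → a)
  neither : ∀ {A B : Set} → ¬ A → ¬ B → A ⇔ B
  neither ¬a ¬b = mk⇔ (λ a → contradiction a ¬a) (λ b → contradiction b ¬b)
  iso : ∀ a b → lookup p132 a < lookup p132 b ⇔ lookup (x ∷ y ∷ z ∷ []) a < lookup (x ∷ y ∷ z ∷ []) b
  iso zero             zero             = neither (<-irrefl refl) (<-irrefl refl)
  iso zero             (suc zero)       = both (s<s z<s) (<-trans x<z z<y)
  iso zero             (suc (suc zero)) = both (s<s z<s) x<z
  iso (suc zero)       zero             = neither (<-asym (s<s z<s)) (<-asym (<-trans x<z z<y))
  iso (suc zero)       (suc zero)       = neither (<-irrefl refl) (<-irrefl refl)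
  iso (suc zero)       (suc (suc zero)) = neither (<-asym (s<s (s<s z<s))) (<-asym z<y)
  iso (suc (suc zero)) zero             = neither (<-asym (s<s z<s)) (<-asym x<z)
  iso (suc (suc zero)) (suc zero)       = both (s<s (s<s z<s)) z<y
  iso (suc (suc zero)) (suc (suc zero)) = neither (<-irrefl refl) (<-irrefl refl)

has132⇒contains : ∀ w → Has132 w → Contains w p132
has132⇒contains w (x , y , z , s , x<z , z<y) =
  positions s , positions-mono s ,
  λ a b → subst₂ (λ m n → lookup p132 a < lookup p132 b ⇔ m < n)
    (sym (lookup-positions s a)) (sym (lookup-positions s b)) (132-isomorphic x<z z<y a b)

-- An ascent of the code, at the neighbouring letters x and y, is witnessed by
-- a later letter z with x < z < y.
avoids⇒decreasing : ∀ {w} → Unique w → ¬ Has132 w → Linked _≥_ (code w)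
avoids⇒decreasing {[]}         _                    _      = []
avoids⇒decreasing {x ∷ []}     _                    _      = [-]
avoids⇒decreasing {x ∷ y ∷ w} ((x≢y ∷ x∉w) ∷ unique) no132 =
  ≮⇒≥ no-ascent ∷ avoids⇒decreasing unique
    (λ { (a , b , c , s , a<c , c<b) → no132 (a , b , c , x ∷ʳ s , a<c , c<b) })
  where
  no-ascent : ¬ (below x (y ∷ w) < below y w)
  no-ascent lt with find (below-gap w (≤-<-trans (below-∷ x y w) lt))
  ... | z , z∈w , x≤z , z<y =
    no132 (x , y , z , refl ∷ refl ∷ from∈ z∈w , ≤∧≢⇒< x≤z (All.lookup x∉w z∈w) , z<y)

-- Only an occurrence x y z using the first letter x needs an argument; let u be
-- the second letter of the word. If u < z, then u y z is an occurrence in the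
-- tail. If u > z, then z is counted by the code at u, but not at x, and everything
-- counted at x is counted at u, so the code has an ascent.
decreasing⇒avoids : ∀ {w} → Unique w → Linked _≥_ (code w) → ¬ Has132 w
decreasing⇒avoids {x ∷ w} (_ ∷ unique) decr (a , b , c , _ ∷ʳ s , a<c , c<b) =
  decreasing⇒avoids unique (Linked.tail decr) (a , b , c , s , a<c , c<b)
decreasing⇒avoids {x ∷ u ∷ v} (_ ∷ (u∉v ∷ unique)) decr (.x , y , z , refl ∷ s , x<z , z<y) =
  first-letter (decreasing⇒avoids (u∉v ∷ unique) (Linked.tail decr)) s
  where
  z≮u : z ∈ v → ¬ (z < u)
  z≮u z∈v z<u = <⇒≱ (below-strict z∈v (<⇒≤ x<z) z<u)
    (subst (_≥ below u v) (below-∷-≥ v (<⇒≤ (<-trans x<z z<u))) (Linked.head decr))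
  first-letter : ¬ Has132 (u ∷ v) → y ∷ z ∷ [] ⊆ u ∷ v → ⊥
  first-letter _     (refl ∷ t) = z≮u (to∈ t) z<y
  first-letter no132 (.u ∷ʳ t) with <-cmp u z
  ... | tri< u<z _ _  = no132 (u , y , z , refl ∷ t , u<z , z<y)
  ... | tri≈ _ refl _ = All.lookup u∉v (to∈ (∷ˡ⁻ t)) refl
  ... | tri> _ _ z<u = z≮u (to∈ (∷ˡ⁻ t)) z<u

-- Permutations

-- The permutation 1, …, n.
identity : ℕ → Word
identity n = map suc (upTo n)

length-identity : ∀ n → length (identity n) ≡ n
length-identity n = trans (length-map suc (upTo n)) (length-upTo n)

identity-isPermutation : ∀ n → IsPermutation (identity n)
identity-isPermutation n = ↭-reflexive (cong identity (sym (length-identity n)))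

applyUpTo-+ : ∀ {A : Set} (g : ℕ → A) m n → applyUpTo g (m + n) ≡ applyUpTo g m ++ applyUpTo (g ∘ (m +_)) n
applyUpTo-+ g zero    n = refl
applyUpTo-+ g (suc m) n = cong (g 0 ∷_) (applyUpTo-+ (g ∘ suc) m n)

identity-+ : ∀ m n → identity (m + n) ≡ identity m ++ map (m +_) (identity n)
identity-+ m n = begin
  identity (m + n)                                     ≡⟨ map-upTo suc (m + n) ⟩
  applyUpTo suc (m + n)                                ≡⟨ applyUpTo-+ suc m n ⟩
  applyUpTo suc m ++ applyUpTo (λ i → suc (m + i)) n   ≡⟨ cong₂ _++_ (map-upTo suc m) (map-upTo (λ i → suc (m + i)) n) ⟨
  identity m ++ map (λ i → suc (m + i)) (upTo n)       ≡⟨ cong (identity m ++_) (map-cong (λ i → sym (+-suc m i)) (upTo n)) ⟩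
  identity m ++ map (λ i → m + suc i) (upTo n)         ≡⟨ cong (identity m ++_) (map-∘ (upTo n)) ⟩
  identity m ++ map (m +_) (identity n)                ∎
  where open ≡-Reasoning

identity-bounds : ∀ n → All (λ v → 0 < v × v ≤ n) (identity n)
identity-bounds n = All.map⁺ (All.applyUpTo⁺₁ id n (λ i<n → z<s , i<n))

module _ {π : Word} (π-perm : IsPermutation π) where

  permutation-bounds : All (λ v → 0 < v × v ≤ length π) π
  permutation-bounds = All-resp-↭ (↭-sym π-perm) (identity-bounds (length π))

  permutation-positive : All (0 <_) π
  permutation-positive = All.map proj₁ permutation-bounds

  permutation-≤ : All (_≤ length π) π
  permutation-≤ = All.map proj₂ permutation-bounds

  permutation-unique : Unique π
  permutation-unique = Permutationₛ.Unique-resp-↭ (setoid ℕ) (↭⇒↭ₛ (↭-sym π-perm))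
    (Unique.map⁺ suc-injective (Unique.upTo⁺ (length π)))

code-⊕ : ∀ {ρ τ} → IsPermutation ρ → IsPermutation τ → code (ρ ⊕ τ) ≡ code ρ ++ code τ
code-⊕ {ρ} {τ} ρ-perm τ-perm = code-++ (length ρ) ρ τ (permutation-≤ ρ-perm) (permutation-positive τ-perm)

length-⊕ : ∀ ρ τ → length (ρ ⊕ τ) ≡ length ρ + length τ
length-⊕ ρ τ = trans (length-++ ρ) (cong (length ρ +_) (length-map (length ρ +_) τ))

⊕-isPermutation : ∀ {ρ τ} → IsPermutation ρ → IsPermutation τ → IsPermutation (ρ ⊕ τ)
⊕-isPermutation {ρ} {τ} ρ-perm τ-perm = ↭-trans (++⁺ ρ-perm (map⁺ (length ρ +_) τ-perm))
  (↭-reflexive (trans (sym (identity-+ (length ρ) (length τ))) (cong identity (sym (length-⊕ ρ τ)))))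

code-injective-permutation : ∀ {π σ} → IsPermutation π → IsPermutation σ → code π ≡ code σ → π ≡ σ
code-injective-permutation {π} {σ} π-perm σ-perm eq =
  code-injective (↭-trans π-perm (↭-trans (↭-reflexive (cong identity length-eq)) (↭-sym σ-perm))) eq
  where
  length-eq : length π ≡ length σ
  length-eq = trans (sym (length-code π)) (trans (cong length eq) (length-code σ))

code-identity : ∀ n → code (identity n) ≡ replicate n 0
code-identity zero    = refl
code-identity (suc n) = begin
  code (identity (1 + n))              ≡⟨ cong code (identity-+ 1 n) ⟩
  code (identity 1 ⊕ identity n)       ≡⟨ code-⊕ (identity-isPermutation 1) (identity-isPermutation n) ⟩
  0 ∷ code (identity n)                ≡⟨ cong (0 ∷_) (code-identity n) ⟩
  replicate (suc n) 0                  ∎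
  where open ≡-Reasoning

-- Prepending a letter with a prescribed code entry

-- The increasing enumeration of the naturals other than a.
skip : ℕ → ℕ → ℕ
skip zero    v       = suc v
skip (suc a) zero    = zero
skip (suc a) (suc v) = suc (skip a v)

skip-strictlyMonotone : ∀ a → StrictlyMonotone (skip a)
skip-strictlyMonotone a x y = mk⇔ (mono a) (cancel a x y)
  where
  mono : ∀ a {x y} → x < y → skip a x < skip a y
  mono zero    x<y = s<s x<y
  mono (suc a) {zero}  {suc y} _   = z<s
  mono (suc a) {suc x} {suc y} x<y = s<s (mono a (s<s⁻¹ x<y))
  cancel : ∀ a x y → skip a x < skip a y → x < y
  cancel zero    x       y       lt = s<s⁻¹ lt
  cancel (suc a) zero    (suc y) _  = z<s
  cancel (suc a) (suc x) (suc y) lt = s<s (cancel a x y (s<s⁻¹ lt))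

skip-< : ∀ a v → v < a → skip a v ≡ v
skip-< (suc a) zero    _   = refl
skip-< (suc a) (suc v) v<a = cong suc (skip-< a v (s<s⁻¹ v<a))

skip-≥ : ∀ a v → skip a (a + v) ≡ suc (a + v)
skip-≥ zero    v = refl
skip-≥ (suc a) v = cong suc (skip-≥ a v)

v≤skip : ∀ a v → v ≤ skip a v
v≤skip zero    v       = n≤1+n v
v≤skip (suc a) zero    = z≤n
v≤skip (suc a) (suc v) = s≤s (v≤skip a v)

below-skip : ∀ a w → below a (map (skip a) w) ≡ below a w
below-skip a w = trans (length-filter-map (_<? a) (skip a) w)
  (cong length (filter-≐ (λ v → skip a v <? a) (_<? a)
    ((λ {v} → ≤-<-trans (v≤skip a v)) , (λ {v} v<a → subst (_< a) (sym (skip-< a v v<a)) v<a)) w))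

-- The word with first letter a + 1 whose other letters are in the same
-- relative order as w.
prepend : ℕ → Word → Word
prepend a w = suc a ∷ map (skip (suc a)) w

length-prepend : ∀ a w → length (prepend a w) ≡ suc (length w)
length-prepend a w = cong suc (length-map (skip (suc a)) w)

map-skip-identity : ∀ a m → map (skip (suc a)) (identity (a + m)) ≡ identity a ++ map (suc a +_) (identity m)
map-skip-identity a m = begin
  map (skip (suc a)) (identity (a + m))
    ≡⟨ cong (map (skip (suc a))) (identity-+ a m) ⟩
  map (skip (suc a)) (identity a ++ map (a +_) (identity m))
    ≡⟨ map-++ (skip (suc a)) (identity a) _ ⟩
  map (skip (suc a)) (identity a) ++ map (skip (suc a)) (map (a +_) (identity m))
    ≡⟨ cong₂ _++_
         (map-id-local (All.map (λ (_ , v≤a) → skip-< (suc a) _ (s≤s v≤a)) (identity-bounds a)))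
         (trans (sym (map-∘ (identity m)))
           (map-cong-local (All.map (λ (v>0 , _) → skip-a+v v>0) (identity-bounds m)))) ⟩
  identity a ++ map (suc a +_) (identity m) ∎
  where
  open ≡-Reasoning
  skip-a+v : ∀ {v} → 0 < v → skip (suc a) (a + v) ≡ suc a + v
  skip-a+v {suc v} _ rewrite +-suc a v = cong suc (skip-≥ a v)

-- Writing the length of w as a + m separates the letters of w that keep their
-- value from those that are raised by one.
prepend-↭ : ∀ a m {w} → w ↭ identity (a + m) → prepend a w ↭ identity (suc (a + m))
prepend-↭ a m {w} w↭ = ↭-trans (prep (suc a) (↭-trans (map⁺ (skip (suc a)) w↭) (↭-reflexive (map-skip-identity a m))))
  (↭-trans (↭-sym (shift (suc a) (identity a) (map (suc a +_) (identity m)))) (↭-reflexive eq))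
  where
  open ≡-Reasoning
  eq : identity a ++ suc a ∷ map (suc a +_) (identity m) ≡ identity (suc (a + m))
  eq = begin
    identity a ++ suc a ∷ map (suc a +_) (identity m)
      ≡⟨ ++-assoc (identity a) (suc a ∷ []) _ ⟨
    (identity a ++ suc a ∷ []) ++ map (suc a +_) (identity m)
      ≡⟨ cong (λ v → (identity a ++ v ∷ []) ++ map (suc a +_) (identity m)) (+-comm 1 a) ⟩
    (identity a ++ map (a +_) (identity 1)) ++ map (suc a +_) (identity m)
      ≡⟨ cong (_++ map (suc a +_) (identity m)) (trans (sym (identity-+ a 1)) (cong identity (+-comm a 1))) ⟩
    identity (suc a) ++ map (suc a +_) (identity m)
      ≡⟨ identity-+ (suc a) m ⟨
    identity (suc (a + m)) ∎

prepend-isPermutation : ∀ {a w} → IsPermutation w → a ≤ length w → IsPermutation (prepend a w)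
prepend-isPermutation {a} {w} w-perm a≤n = ↭-trans
  (prepend-↭ a (length w ∸ a) (↭-trans w-perm (↭-reflexive (cong identity (sym (m+[n∸m]≡n a≤n))))))
  (↭-reflexive (cong identity (trans (cong suc (m+[n∸m]≡n a≤n)) (sym (length-prepend a w)))))

below-identity : ∀ a m → below (suc a) (identity (a + m)) ≡ a
below-identity a m = begin
  below (suc a) (identity (a + m))
    ≡⟨ cong (below (suc a)) (identity-+ a m) ⟩
  below (suc a) (identity a ++ map (a +_) (identity m))
    ≡⟨ below-++ (suc a) (identity a) _ ⟩
  below (suc a) (identity a) + below (suc a) (map (a +_) (identity m))
    ≡⟨ cong₂ _+_
         (cong length (filter-all (_<? suc a) (All.map (λ (_ , v≤a) → s≤s v≤a) (identity-bounds a))))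
         (below-none (All.map⁺ (All.map (λ (v>0 , _) → ≤-trans (≤-reflexive (+-comm 1 a)) (+-monoʳ-≤ a v>0)) (identity-bounds m)))) ⟩
  length (identity a) + 0
    ≡⟨ trans (+-identityʳ _) (length-identity a) ⟩
  a ∎
  where open ≡-Reasoning

code-prepend : ∀ {a w} → IsPermutation w → a ≤ length w → code (prepend a w) ≡ a ∷ code w
code-prepend {a} {w} w-perm a≤n = cong₂ _∷_
  (begin
    below (suc a) (map (skip (suc a)) w)
      ≡⟨ below-skip (suc a) w ⟩
    below (suc a) w
      ≡⟨ below-↭ (suc a) w-perm ⟩
    below (suc a) (identity (length w))
      ≡⟨ cong (below (suc a) ∘ identity) (m+[n∸m]≡n a≤n) ⟨
    below (suc a) (identity (a + (length w ∸ a)))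
      ≡⟨ below-identity a (length w ∸ a) ⟩
    a ∎)
  (code-map (skip-strictlyMonotone (suc a)) w)
  where open ≡-Reasoning

-- Partitions and 132-avoiding permutations

-- The positive entries of the code.
parts : Word → List ℕ
parts w = filter (_>? 0) (code w)

-- The shortest non-empty permutation whose code is the given list of positive parts
-- followed by zeros. A code entry a needs at least a later letters, which the
-- identity summand provides. The empty partition gives the permutation 1.
fromParts : List ℕ → Word
fromParts []       = identity 1
fromParts (a ∷ ps) = prepend a (fromParts ps ⊕ identity (a ∸ length (fromParts ps)))

⊕-identity-isPermutation : ∀ {π} m → IsPermutation π → IsPermutation (π ⊕ identity m)
⊕-identity-isPermutation m π-perm = ⊕-isPermutation π-perm (identity-isPermutation m)

length-⊕-identity : ∀ π m → length (π ⊕ identity m) ≡ length π + m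
length-⊕-identity π m = trans (length-⊕ π (identity m)) (cong (length π +_) (length-identity m))

code-⊕-identity : ∀ {π} m → IsPermutation π → code (π ⊕ identity m) ≡ code π ++ replicate m 0
code-⊕-identity {π} m π-perm =
  trans (code-⊕ π-perm (identity-isPermutation m)) (cong (code π ++_) (code-identity m))

⊕-identity-long : ∀ a π → a ≤ length (π ⊕ identity (a ∸ length π))
⊕-identity-long a π = ≤-trans (m≤n+m∸n a (length π)) (≤-reflexive (sym (length-⊕-identity π _)))

fromParts-isPermutation : ∀ ps → IsPermutation (fromParts ps)
fromParts-isPermutation []       = ↭-refl
fromParts-isPermutation (a ∷ ps) = prepend-isPermutation
  (⊕-identity-isPermutation _ (fromParts-isPermutation ps)) (⊕-identity-long a (fromParts ps))

length-fromParts-∷ : ∀ a ps →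
  length (fromParts (a ∷ ps)) ≡ suc (length (fromParts ps) + (a ∸ length (fromParts ps)))
length-fromParts-∷ a ps = trans (length-prepend a (fromParts ps ⊕ identity _)) (cong suc (length-⊕-identity (fromParts ps) _))

fromParts-≢[] : ∀ ps → fromParts ps ≢ []
fromParts-≢[] []       ()
fromParts-≢[] (a ∷ ps) ()

-- The list c consists of ps followed by zeros.
_PaddedTo_ : List ℕ → List ℕ → Set
ps PaddedTo c = ∃[ m ] c ≡ ps ++ replicate m 0

replicate-+ : ∀ m n → replicate (m + n) 0 ≡ replicate m 0 ++ replicate n 0
replicate-+ zero    n = refl
replicate-+ (suc m) n = cong (0 ∷_) (replicate-+ m n)

paddedTo-++ : ∀ {ps c} n → ps PaddedTo c → ps PaddedTo (c ++ replicate n 0)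
paddedTo-++ {ps} n (m , refl) = m + n ,
  trans (++-assoc ps (replicate m 0) (replicate n 0)) (cong (ps ++_) (sym (replicate-+ m n)))

paddedTo-unique : ∀ {ps c d} → ps PaddedTo c → ps PaddedTo d → length c ≡ length d → c ≡ d
paddedTo-unique {ps} (m , refl) (n , refl) eq = cong (λ k → ps ++ replicate k 0) (+-cancelˡ-≡ (length ps) m n (begin
  length ps + m                      ≡⟨ length-padded m ⟨
  length (ps ++ replicate m 0)       ≡⟨ eq ⟩
  length (ps ++ replicate n 0)       ≡⟨ length-padded n ⟩
  length ps + n                      ∎))
  where
  open ≡-Reasoning
  length-padded : ∀ k → length (ps ++ replicate k 0) ≡ length ps + k
  length-padded k = trans (length-++ ps) (cong (length ps +_) (length-replicate k))

code-fromParts : ∀ ps → ps PaddedTo code (fromParts ps)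
code-fromParts []       = 1 , refl
code-fromParts (a ∷ ps) with paddedTo-++ (a ∸ length (fromParts ps)) (code-fromParts ps)
... | m , eq = m , (begin
  code (prepend a (fromParts ps ⊕ identity _))
    ≡⟨ code-prepend (⊕-identity-isPermutation _ (fromParts-isPermutation ps)) (⊕-identity-long a (fromParts ps)) ⟩
  a ∷ code (fromParts ps ⊕ identity _)
    ≡⟨ cong (a ∷_) (trans (code-⊕-identity _ (fromParts-isPermutation ps)) eq) ⟩
  a ∷ ps ++ replicate m 0 ∎)
  where open ≡-Reasoning

replicate-zero : ∀ n → All (_≡ 0) (replicate n 0)
replicate-zero n = All.replicate⁺ n refl

positive-padded : ∀ {ps c} → All (_> 0) ps → ps PaddedTo c → filter (_>? 0) c ≡ ps
positive-padded {ps} ps>0 (m , refl) = begin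
  filter (_>? 0) (ps ++ replicate m 0)                  ≡⟨ filter-++ (_>? 0) ps _ ⟩
  filter (_>? 0) ps ++ filter (_>? 0) (replicate m 0)
    ≡⟨ cong₂ _++_ (filter-all (_>? 0) ps>0) (filter-none (_>? 0) (All.map (λ { refl () }) (replicate-zero m))) ⟩
  ps ++ []                                              ≡⟨ ++-identityʳ ps ⟩
  ps                                                    ∎
  where open ≡-Reasoning

parts-fromParts : ∀ {ps} → All (_> 0) ps → parts (fromParts ps) ≡ ps
parts-fromParts {ps} ps>0 = positive-padded ps>0 (code-fromParts ps)

decreasing-allPairs : ∀ {c} → Linked _≥_ c → AllPairs _≥_ c
decreasing-allPairs = Linked.Linked⇒AllPairs (λ x≥y y≥z → ≤-trans y≥z x≥y)

decreasing-padded : ∀ {ps c} → Linked _≥_ ps → ps PaddedTo c → Linked _≥_ c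
decreasing-padded {ps} decr (m , refl) = Linked.AllPairs⇒Linked (AllPairs.++⁺
  (decreasing-allPairs decr)
  (zeros m)
  (All.universal (λ x → All.map (λ { refl → z≤n }) (replicate-zero m)) ps))
  where
  zeros : ∀ m → AllPairs _≥_ (replicate m 0)
  zeros zero    = []
  zeros (suc m) = All.map (λ { refl → z≤n }) (replicate-zero m) ∷ zeros m

all-zero-padded : ∀ {c} → All (_≤ 0) c → [] PaddedTo c
all-zero-padded []           = 0 , refl
all-zero-padded (z≤n ∷ c≤0) with all-zero-padded c≤0
... | m , eq = suc m , cong (0 ∷_) eq

decreasing⇒padded : ∀ {c} → AllPairs _≥_ c → filter (_>? 0) c PaddedTo c
decreasing⇒padded []                           = 0 , refl
decreasing⇒padded {zero ∷ c}  (c≤0 ∷ _)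
  rewrite filter-none (_>? 0) (All.map ≤⇒≯ c≤0) = all-zero-padded (z≤n ∷ c≤0)
decreasing⇒padded {suc x ∷ c} (_ ∷ decr) with decreasing⇒padded decr
... | m , eq = m , cong (suc x ∷_) eq

padded-sum : ∀ {ps c} → ps PaddedTo c → sum c ≡ sum ps
padded-sum {ps} (m , refl) = trans (sum-++ ps (replicate m 0)) (trans (cong (sum ps +_) (sum-zeros m)) (+-identityʳ _))
  where
  sum-zeros : ∀ m → sum (replicate m 0) ≡ 0
  sum-zeros zero    = refl
  sum-zeros (suc m) = sum-zeros m

-- A code entry a is followed by at least a letters in any word, so no word with
-- the given parts is shorter than the one built by fromParts.
length-fromParts-parts : ∀ π → π ≢ [] → length (fromParts (parts π)) ≤ length π
length-fromParts-parts []      π≢[] = contradiction refl π≢[]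
length-fromParts-parts (x ∷ w) _ = by-entry (below x w) (length-filter (_<? x) w)
  where
  tail-bound : ∀ w → length (fromParts (parts w)) ≤ suc (length w)
  tail-bound []      = ≤-refl
  tail-bound (y ∷ w) = m≤n⇒m≤1+n (length-fromParts-parts (y ∷ w) (λ ()))
  -- A positive entry contributes a part, while a zero entry leaves parts unchanged.
  by-entry : ∀ a → a ≤ length w → length (fromParts (filter (_>? 0) (a ∷ code w))) ≤ suc (length w)
  by-entry zero    _   = tail-bound w
  by-entry (suc a) a<n = ≤-trans (≤-reflexive (length-fromParts-∷ (suc a) (parts w))) (s≤s (+-∸-≤ rest a<n))
    where
    rest : length (fromParts (parts w)) ≤ length w
    rest = length-fromParts-parts w (λ { refl → contradiction a<n λ () })
    +-∸-≤ : ∀ {a l n} → l ≤ n → a ≤ n → l + (a ∸ l) ≤ n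
    +-∸-≤ {a} {l} {n} l≤n a≤n = ≤-trans (+-monoʳ-≤ l (∸-monoˡ-≤ l a≤n)) (≤-reflexive (m+[n∸m]≡n l≤n))

-- The last entry of the code of a non-empty word is zero.
decreasing-after-zero : ∀ ρ {c} → ρ ≢ [] → AllPairs _≥_ (code ρ ++ c) → All (_≤ 0) c
decreasing-after-zero []          ρ≢[] _          = contradiction refl ρ≢[]
decreasing-after-zero (x ∷ [])    _    (c≤0 ∷ _)  = c≤0
decreasing-after-zero (x ∷ y ∷ ρ) _    (_ ∷ decr) = decreasing-after-zero (y ∷ ρ) (λ ()) decr

parts-⊕ : ∀ {ρ τ} → IsPermutation ρ → IsPermutation τ → ρ ≢ [] → AllPairs _≥_ (code (ρ ⊕ τ)) → parts (ρ ⊕ τ) ≡ parts ρ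
parts-⊕ {ρ} {τ} ρ-perm τ-perm ρ≢[] decr = begin
  filter (_>? 0) (code (ρ ⊕ τ))      ≡⟨ cong (filter (_>? 0)) (code-⊕ ρ-perm τ-perm) ⟩
  filter (_>? 0) (code ρ ++ code τ)  ≡⟨ filter-++ (_>? 0) (code ρ) (code τ) ⟩
  parts ρ ++ parts τ
    ≡⟨ cong (parts ρ ++_) (filter-none (_>? 0) (All.map ≤⇒≯
         (decreasing-after-zero ρ ρ≢[] (subst (AllPairs _≥_) (code-⊕ ρ-perm τ-perm) decr)))) ⟩
  parts ρ ++ []                      ≡⟨ ++-identityʳ (parts ρ) ⟩
  parts ρ                            ∎
  where open ≡-Reasoning

fromParts-indecomposable : ∀ {ps} → All (_> 0) ps → Linked _≥_ ps → ¬ Decomposable (fromParts ps)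
fromParts-indecomposable {ps} ps>0 decr (ρ , τ , ρ-perm , ρ≢[] , τ-perm , τ≢[] , eq) = <-irrefl refl (begin-strict
  length (fromParts ps)           ≡⟨ cong (length ∘ fromParts) parts-eq ⟩
  length (fromParts (parts ρ))    ≤⟨ length-fromParts-parts ρ ρ≢[] ⟩
  length ρ                        <⟨ m<m+n (length ρ) (length-positive τ≢[]) ⟩
  length ρ + length τ             ≡⟨ length-⊕ ρ τ ⟨
  length (ρ ⊕ τ)                  ≡⟨ cong length eq ⟨
  length (fromParts ps)           ∎)
  where
  open ≤-Reasoning
  length-positive : ∀ {w : Word} → w ≢ [] → 0 < length w
  length-positive {[]}    w≢[] = contradiction refl w≢[]
  length-positive {x ∷ w} _    = z<s
  parts-eq : ps ≡ parts ρ
  parts-eq = trans (sym (parts-fromParts ps>0)) (trans (cong parts eq) (parts-⊕ ρ-perm τ-perm ρ≢[]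
    (subst (AllPairs _≥_ ∘ code) eq (decreasing-allPairs (decreasing-padded decr (code-fromParts ps))))))

fromParts∈I : ∀ {k ps} → IsPartitionOf k ps → I k (p132 ∷ []) (fromParts ps)
fromParts∈I {k} {ps} (decr , ps>0 , sum≡k) =
  fromParts-isPermutation ps ,
  (fromParts-≢[] ps , fromParts-indecomposable ps>0 decr) ,
  trans (inversions≡sum-code (fromParts ps)) (trans (padded-sum (code-fromParts ps)) sum≡k) ,
  (decreasing⇒avoids (permutation-unique (fromParts-isPermutation ps)) (decreasing-padded decr (code-fromParts ps))
     ∘ contains⇒has132 (fromParts ps)) ∷ []

code-decreasing : ∀ {π} → IsPermutation π → Avoids π p132 → AllPairs _≥_ (code π)
code-decreasing {π} π-perm avoids = decreasing-allPairs (avoids⇒decreasing (permutation-unique π-perm) (avoids ∘ has132⇒contains π))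

parts-isPartition : ∀ {k π} → I k (p132 ∷ []) π → IsPartitionOf k (parts π)
parts-isPartition {k} {π} (π-perm , _ , inv≡k , avoids ∷ []) =
  Linked.AllPairs⇒Linked (AllPairs.filter⁺ (_>? 0) decr) ,
  All.all-filter (_>? 0) (code π) ,
  trans (sym (padded-sum (decreasing⇒padded decr))) (trans (sym (inversions≡sum-code π)) inv≡k)
  where decr = code-decreasing π-perm avoids

-- Both sides have the same parts and the same length, hence the same code.
fromParts-⊕-identity : ∀ {π} → IsPermutation π → π ≢ [] → Avoids π p132 →
  π ≡ fromParts (parts π) ⊕ identity (length π ∸ length (fromParts (parts π)))
fromParts-⊕-identity {π} π-perm π≢[] avoids = code-injective-permutation π-perm
  (⊕-identity-isPermutation m σ-perm)
  (paddedTo-unique (decreasing⇒padded (code-decreasing π-perm avoids))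
    (subst (parts π PaddedTo_) (sym (code-⊕-identity m σ-perm)) (paddedTo-++ m (code-fromParts (parts π))))
    (begin
      length (code π)                  ≡⟨ length-code π ⟩
      length π                         ≡⟨ m+[n∸m]≡n (length-fromParts-parts π π≢[]) ⟨
      length σ + m                     ≡⟨ length-⊕-identity σ m ⟨
      length (σ ⊕ identity m)          ≡⟨ length-code (σ ⊕ identity m) ⟨
      length (code (σ ⊕ identity m))   ∎))
  where
  open ≡-Reasoning
  σ = fromParts (parts π)
  m = length π ∸ length σ
  σ-perm = fromParts-isPermutation (parts π)

fromParts-parts : ∀ {k π} → I k (p132 ∷ []) π → fromParts (parts π) ≡ π
fromParts-parts {k} {π} (π-perm , (π≢[] , indec) , _ , avoids ∷ []) =
  sym (no-identity (length π ∸ length σ) (fromParts-⊕-identity π-perm π≢[] avoids))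
  where
  σ = fromParts (parts π)
  no-identity : ∀ m → π ≡ σ ⊕ identity m → π ≡ σ
  no-identity zero    eq = trans eq (++-identityʳ σ)
  no-identity (suc m) eq = contradiction
    (σ , identity (suc m) , fromParts-isPermutation (parts π) , fromParts-≢[] (parts π) ,
      identity-isPermutation (suc m) , (λ ()) , eq)
    indec

-- Cardinalities

-- It suffices that f and g are inverse to each other on the two subsets.
HasCardinality-↔ : ∀ {A B : Set} {P : Pred A 0ℓ} {Q : Pred B 0ℓ} {n} (f : A → B) (g : B → A) →
  (∀ {x} → P x → Q (f x)) → (∀ {y} → Q y → P (g y)) →
  (∀ {x} → P x → g (f x) ≡ x) → (∀ {y} → Q y → f (g y) ≡ y) →
  HasCardinality P n → HasCardinality Q n
HasCardinality-↔ {Q = Q} f g P⇒Q Q⇒P gf fg (xs , unique , ∈⇔P , len) =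
  map f xs ,
  Unique.map⁻ (subst Unique (sym map-gf) unique) ,
  (λ y → mk⇔ from-∈ (λ q → subst (_∈ map f xs) (fg q) (∈-map⁺ f (Equivalence.from (∈⇔P (g y)) (Q⇒P q))))) ,
  trans (length-map f xs) len
  where
  map-gf : map g (map f xs) ≡ xs
  map-gf = trans (sym (map-∘ xs)) (map-id-local (All.tabulate (λ {x} x∈xs → gf (Equivalence.to (∈⇔P x) x∈xs))))
  from-∈ : ∀ {y} → y ∈ map f xs → Q y
  from-∈ y∈ with ∈-map⁻ f y∈
  ... | x , x∈xs , refl = P⇒Q (Equivalence.to (∈⇔P x) x∈xs)

-- All lists of at most m numbers that are at most k.
boundedLists : ℕ → ℕ → List (List ℕ)
boundedLists k zero    = [] ∷ []
boundedLists k (suc m) = [] ∷ cartesianProductWith _∷_ (upTo (suc k)) (boundedLists k m)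

∈-boundedLists : ∀ {k} m {ps} → m ≤ k → All (_> 0) ps → sum ps ≤ m → ps ∈ boundedLists k m
∈-boundedLists zero    _   []             _   = here refl
∈-boundedLists (suc m) _   []             _   = here refl
∈-boundedLists zero    _   (_∷_ {suc a} _ _) ()
∈-boundedLists (suc m) m<k (_∷_ {suc a} a>0 ps>0) sum≤ = there (∈-cartesianProductWith⁺ _∷_
  (∈-upTo⁺ (s≤s (≤-trans (m+n≤o⇒m≤o (suc a) sum≤) m<k)))
  (∈-boundedLists m (<⇒≤ m<k) ps>0 (m+n≤o⇒n≤o a (s≤s⁻¹ sum≤))))

isPartitionOf? : ∀ k → Decidable (IsPartitionOf k)
isPartitionOf? k ps = Linked.linked? _≥?_ ps ×-dec (All.all? (_>? 0) ps ×-dec (sum ps ≟ k))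

-- The partitions of k, each listed once.
partitions : ℕ → List (List ℕ)
partitions k = filter (isPartitionOf? k) (deduplicate (≡-dec _≟_) (boundedLists k k))

partitions-cardinality : ∀ k → HasCardinality (IsPartitionOf k) (length (partitions k))
partitions-cardinality k =
  partitions k ,
  Unique.filter⁺ (isPartitionOf? k) (deduplicate-! (≡-dec _≟_) (boundedLists k k)) ,
  (λ ps → mk⇔ (proj₂ ∘ ∈-filter⁻ (isPartitionOf? k) {xs = deduplicate (≡-dec _≟_) (boundedLists k k)})
    (λ { p@(_ , ps>0 , sum≡k) → ∈-filter⁺ (isPartitionOf? k)
      (∈-deduplicate⁺ (≡-dec _≟_) (∈-boundedLists k ≤-refl ps>0 (≤-reflexive sum≡k))) p })) ,
  refl

theorem3 : (k : ℕ) → ∃[ n ] (HasCardinality (I k ((1 ∷ 3 ∷ 2 ∷ []) ∷ [])) n × HasCardinality (IsPartitionOf k) n)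
theorem3 k = length (partitions k) ,
  HasCardinality-↔ fromParts parts fromParts∈I parts-isPartition (λ (_ , ps>0 , _) → parts-fromParts ps>0) fromParts-parts
    (partitions-cardinality k) ,
  partitions-cardinality k
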